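{- Let $G$ be an abstract Kripke graph, $\Gamma$ a context, $p$ a polarity, $A$ a formula and $n$ a node. If $[\![G;\Gamma\vdash p\,A@n]\!]_N$ holds for every Kripke model $(W,R,V)$ and every node interpreter $N$ (on the nodes occurring in the sequent), then $G;\Gamma\vdash p\,A@n$ is derivable in DIL, where DIL is taken with the axiom-cut rules (axCut) and (axCutBar) in place of the general cut rule.
   Context: **Syntax.** Polarities are $p\in\{+,-\}$, with $\bar{+}=-$ and $\bar{ - }=+$. Formulas: $A,B ::= a \mid \langle p\rangle \mid A\to_p B \mid A\wedge_p B$, where $a$ ranges over atomic formulas. Abstract Kripke graphs $G$ are finite lists of edges $n\preccurlyeq_p n'$, with $n,n'$ nodes (labels). Contexts $\Gamma$ are finite lists of labelled signed formulas $p\,A@n$. A comma denotes concatenation; $|G|$ and $|\Gamma|$ are the lists of nodes occurring in $G$ and $\Gamma$. A sequent is $G;\Gamma\vdash p\,A@n$. **Reachability** $G\vdash n\preccurlyeq^*_p n'$ is inductively generated by: (rel\_ax) $G,n\preccurlyeq_p n',G'\vdash n\preccurlyeq^*_p n'$; (rel\_refl) $G\vdash n\preccurlyeq^*_p n$; (rel\_trans) from $G\vdash n\preccurlyeq^*_p n'$ and $G\vdash n'\preccurlyeq^*_p n''$ infer $G\vdash n\preccurlyeq^*_p n''$; (rel\_flip) from $G\vdash n'\preccurlyeq^*_{\bar p} n$ infer $G\vdash n\preccurlyeq^*_p n'$. **DIL rules (with axiom cuts).** (ax) from $G\vdash n\preccurlyeq^*_p n'$ infer $G;\Gamma,p\,A@n,\Gamma'\vdash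 p\,A@n'$. (unit) $G;\Gamma\vdash p\,\langle p\rangle@n$. (and) from $G;\Gamma\vdash p\,A@n$ and $G;\Gamma\vdash p\,B@n$ infer $G;\Gamma\vdash p\,(A\wedge_p B)@n$. (andBar) for $d\in\{1,2\}$, from $G;\Gamma\vdash p\,A_d@n$ infer $G;\Gamma\vdash p\,(A_1\wedge_{\bar p}A_2)@n$. (imp) if $n'\notin|G|,|\Gamma|$, from $(G,n\preccurlyeq_p n');\Gamma,p\,A@n'\vdash p\,B@n'$ infer $G;\Gamma\vdash p\,(A\to_p B)@n$. (impBar) from $G\vdash n\preccurlyeq^*_{\bar p}n'$, $G;\Gamma\vdash\bar p\,A@n'$ and $G;\Gamma\vdash p\,B@n'$ infer $G;\Gamma\vdash p\,(A\to_{\bar p}B)@n$. (axCut) if $p\,B@n'\in(\Gamma,\bar p\,A@n)$, from $G;\Gamma,\bar p\,A@n\vdash\bar p\,B@n'$ infer $G;\Gamma\vdash p\,A@n$. (axCutBar) if $\bar p\,B@n'\in(\Gamma,\bar p\,A@n)$, from $G;\Gamma,\bar p\,A@n\vdash p\,B@n'$ infer $G;\Gamma\vdash p\,A@n$. **Semantics.** A Kripke model $(W,R,V)$ consists of a set $W$, a preorder $R$ on $W$, and a monotone relation $V$ between worlds and atoms (if $R\,w\,w'$ and $V\,w\,a$ then $V\,w'\,a$). Interpretation of formulas at $w\in W$: $[\![\langle+\rangle]\!]_w=\top$; $[\![\langle-\rangle]\!]_w=\bot$; $[\![a]\!]_w=V\,w\,a$; $[\![A\wedge_+B]\!]_w=[\![A]\!]_w\land[\![B]\!]_w$;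 $[\![A\wedge_-B]\!]_w=[\![A]\!]_w\lor[\![B]\!]_w$; $[\![A\to_+B]\!]_w=\forall w'\in W.\,R\,w\,w'\to[\![A]\!]_{w'}\to[\![B]\!]_{w'}$; $[\![A\to_-B]\!]_w=\exists w'\in W.\,R\,w'\,w\land\lnot[\![A]\!]_{w'}\land[\![B]\!]_{w'}$. A node interpreter $N$ on a set of nodes is a function from that set to $W$. $[\![G]\!]_N$ is the conjunction, over edges of $G$, of $R(N n_1)(N n_2)$ for each edge $n_1\preccurlyeq_+n_2$ and $R(N n_2)(N n_1)$ for each edge $n_1\preccurlyeq_-n_2$. For a meta-level proposition $F$ put $+F=F$ and $-F=\lnot F$; $[\![\Gamma]\!]_N$ is the conjunction over $p\,A@n$ in $\Gamma$ of $p\,[\![A]\!]_{(N n)}$. Finally $[\![G;\Gamma\vdash p\,A@n]\!]_N$ is the statement: if $[\![G]\!]_N$ and $[\![\Gamma]\!]_N$, then $p\,[\![A]\!]_{(N n)}$. -}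

module Defs where

open import Level using (0ℓ)
open import Data.Nat.Base using (ℕ)
open import Data.Sign.Base using (Sign; +; -; opposite)
open import Data.List.Base using (List; []; _∷_; _++_; _∷ʳ_; map; concatMap)
open import Data.List.Membership.Propositional using (_∈_; _∉_)
open import Data.List.Relation.Unary.All using (All)
open import Data.Product.Base using (_×_; ∃-syntax)
open import Data.Sum.Base using (_⊎_)
open import Data.Unit.Base using (⊤)
open import Data.Empty using (⊥)
open import Relation.Nullary.Negation.Core using (¬_)
open import Relation.Binary.Core using (Rel)
open import Relation.Binary.Structures using (IsPreorder)
open import Relation.Binary.PropositionalEquality.Core using (_≡_)

Polarity : Set
Polarity = Sign

-- Atoms and nodes are names from countably infinite supplies.

Atom : Set
Atom = ℕ

Node : Set
Node = ℕ

infixr 7 _∧[_]_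
infixr 6 _⇒[_]_

data Formula : Set where
  atom    : Atom → Formula
  ⟨_⟩     : Polarity → Formula
  _⇒[_]_  : Formula → Polarity → Formula → Formula
  _∧[_]_  : Formula → Polarity → Formula → Formula

infix 5 _≼[_]_ _▸_at_

record Edge : Set where
  constructor _≼[_]_
  field
    source : Node
    label  : Polarity
    target : Node

Graph : Set
Graph = List Edge

record SignedFormula : Set where
  constructor _▸_at_
  field
    sign    : Polarity
    formula : Formula
    node    : Node

Context : Set
Context = List SignedFormula

nodesᴳ : Graph → List Node
nodesᴳ = concatMap (λ e → Edge.source e ∷ Edge.target e ∷ [])

nodesᶜ : Context → List Node
nodesᶜ = map SignedFormula.node

infix 4 _⊢_≼*[_]_

data _⊢_≼*[_]_ : Graph → Node → Polarity → Node → Set where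
  rel-ax    : ∀ {G G' n p n'} →
              G ++ (n ≼[ p ] n') ∷ G' ⊢ n ≼*[ p ] n'
  rel-refl  : ∀ {G n p} →
              G ⊢ n ≼*[ p ] n
  rel-trans : ∀ {G n n' n'' p} →
              G ⊢ n ≼*[ p ] n' → G ⊢ n' ≼*[ p ] n'' → G ⊢ n ≼*[ p ] n''
  rel-flip  : ∀ {G n n' p} →
              G ⊢ n' ≼*[ opposite p ] n → G ⊢ n ≼*[ p ] n'

-- Derivability in DIL with the two axiom-cut rules; there is no general cut.

infix 3 _⨾_⊢_

data _⨾_⊢_ : Graph → Context → SignedFormula → Set where

  ax : ∀ {G Γ Γ' p A n n'} →
    G ⊢ n ≼*[ p ] n' →
    G ⨾ Γ ++ (p ▸ A at n) ∷ Γ' ⊢ p ▸ A at n'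

  unit : ∀ {G Γ p n} →
    G ⨾ Γ ⊢ p ▸ ⟨ p ⟩ at n

  and : ∀ {G Γ p A B n} →
    G ⨾ Γ ⊢ p ▸ A at n →
    G ⨾ Γ ⊢ p ▸ B at n →
    G ⨾ Γ ⊢ p ▸ A ∧[ p ] B at n

  andBar₁ : ∀ {G Γ p A₁ A₂ n} →
    G ⨾ Γ ⊢ p ▸ A₁ at n →
    G ⨾ Γ ⊢ p ▸ A₁ ∧[ opposite p ] A₂ at n

  andBar₂ : ∀ {G Γ p A₁ A₂ n} →
    G ⨾ Γ ⊢ p ▸ A₂ at n →
    G ⨾ Γ ⊢ p ▸ A₁ ∧[ opposite p ] A₂ at n

  imp : ∀ {G Γ p A B n n'} →
    n' ∉ nodesᴳ G →
    n' ∉ nodesᶜ Γ →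
    G ∷ʳ (n ≼[ p ] n') ⨾ Γ ∷ʳ (p ▸ A at n') ⊢ p ▸ B at n' →
    G ⨾ Γ ⊢ p ▸ A ⇒[ p ] B at n

  impBar : ∀ {G Γ p A B n n'} →
    G ⊢ n ≼*[ opposite p ] n' →
    G ⨾ Γ ⊢ opposite p ▸ A at n' →
    G ⨾ Γ ⊢ p ▸ B at n' →
    G ⨾ Γ ⊢ p ▸ A ⇒[ opposite p ] B at n

  axCut : ∀ {G Γ p A B n n'} →
    (p ▸ B at n') ∈ Γ ∷ʳ (opposite p ▸ A at n) →
    G ⨾ Γ ∷ʳ (opposite p ▸ A at n) ⊢ opposite p ▸ B at n' →
    G ⨾ Γ ⊢ p ▸ A at n

  axCutBar : ∀ {G Γ p A B n n'} →
    (opposite p ▸ B at n') ∈ Γ ∷ʳ (opposite p ▸ A at n) →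
    G ⨾ Γ ∷ʳ (opposite p ▸ A at n) ⊢ p ▸ B at n' →
    G ⨾ Γ ⊢ p ▸ A at n

record KripkeModel : Set₁ where
  field
    W          : Set
    R          : Rel W 0ℓ
    V          : W → Atom → Set
    isPreorder : IsPreorder _≡_ R
    monotone   : ∀ {w w' a} → R w w' → V w a → V w' a

-- A node interpreter is a total function on nodes.  A sequent only looks at
-- the values on its own nodes, and any function defined just on those extends
-- to all nodes: the succedent's node guarantees that W is inhabited.

NodeInterpreter : KripkeModel → Set
NodeInterpreter K = Node → KripkeModel.W K

signed : Polarity → Set → Set
signed + F = F
signed - F = ¬ F

module Semantics (K : KripkeModel) where
  open KripkeModel K

  ⟦_⟧ : Formula → W → Set
  ⟦ atom a     ⟧ w = V w a
  ⟦ ⟨ + ⟩      ⟧ w = ⊤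
  ⟦ ⟨ - ⟩      ⟧ w = ⊥
  ⟦ A ∧[ + ] B ⟧ w = ⟦ A ⟧ w × ⟦ B ⟧ w
  ⟦ A ∧[ - ] B ⟧ w = ⟦ A ⟧ w ⊎ ⟦ B ⟧ w
  ⟦ A ⇒[ + ] B ⟧ w = ∀ w' → R w w' → ⟦ A ⟧ w' → ⟦ B ⟧ w'
  ⟦ A ⇒[ - ] B ⟧ w = ∃[ w' ] (R w' w × ¬ ⟦ A ⟧ w' × ⟦ B ⟧ w')

  module _ (N : NodeInterpreter K) where

    ⟦_⟧ᴱ : Edge → Set
    ⟦ n₁ ≼[ + ] n₂ ⟧ᴱ = R (N n₁) (N n₂)
    ⟦ n₁ ≼[ - ] n₂ ⟧ᴱ = R (N n₂) (N n₁)

    ⟦_⟧ᴳ : Graph → Set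
    ⟦ G ⟧ᴳ = All ⟦_⟧ᴱ G

    ⟦_⟧ˢ : SignedFormula → Set
    ⟦ p ▸ A at n ⟧ˢ = signed p (⟦ A ⟧ (N n))

    ⟦_⟧ᶜ : Context → Set
    ⟦ Γ ⟧ᶜ = All ⟦_⟧ˢ Γ

    ⟦_⨾_⊢_⟧ : Graph → Context → SignedFormula → Set
    ⟦ G ⨾ Γ ⊢ φ ⟧ = ⟦ G ⟧ᴳ → ⟦ Γ ⟧ᶜ → ⟦ φ ⟧ˢ

Holds : (K : KripkeModel) → NodeInterpreter K →
        Graph → Context → SignedFormula → Set
Holds K N G Γ φ = Semantics.⟦_⨾_⊢_⟧ K N G Γ φ

module Submission where

-- Refutations in a one-sided tableau calculus, for which cut is admissible,
-- translate into DIL derivations.  Cut lets every node range over the complete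
-- signed types of the subformula closure of the sequent.  Pratt-style
-- elimination discards, one at a time, the types that are locally inconsistent
-- or lack a required successor, each with a tableau refutation; the surviving
-- types form a finite decidable Kripke model.  So a sequent is constructively
-- either derivable or falsified by mapping its nodes to surviving types, and no
-- excluded middle is needed.

open import Function.Base using (_∘_; id; case_of_)
open import Data.Empty using (⊥; ⊥-elim)
open import Data.List.Base using (List; []; _∷_; _++_; _∷ʳ_; map; length)
open import Data.List.Membership.Propositional using (_∈_; _∉_; find; lose)
open import Data.List.Membership.Propositional.Properties using (∈-++⁺ˡ; ∈-++⁺ʳ; ∈-++⁻; ∈-∃++; ∈-map⁺; ∈-map⁻)
open import Data.List.Properties using (length-++-sucʳ)
open import Data.List.Relation.Binary.Subset.Propositional using (_⊆_)
open import Data.List.Relation.Binary.Subset.Propositional.Properties using (∷⁺ʳ; ∈-∷⁺ʳ; ++⁺ʳ)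
open import Data.List.Relation.Unary.All using ([]; _∷_; tabulate)
open import Data.List.Relation.Unary.Any using (Any; here; there; any?)
open import Data.Nat.Base using (suc; _≤_)
open import Data.Nat.ListAction using (sum)
open import Data.Nat.Properties using (m≤m+n; m≤n⇒m≤o+n; 1+n≰n; suc-injective; _≟_)
open import Data.Product.Base using (Σ-syntax; ∃-syntax; _×_; _,_; proj₁; proj₂)
open import Data.Product.Properties using (≡-dec)
open import Data.Sign.Base using (Sign; +; -; opposite)
open import Data.Sign.Properties using (s≢opposite[s]; opposite-involutive) renaming (_≟_ to _≟ˢ_)
open import Data.Sum.Base as Sum using (_⊎_; inj₁; inj₂; [_,_]′)
open import Data.Unit.Base using (⊤; tt)
open import Relation.Binary.Definitions using (DecidableEquality)
open import Relation.Binary.PropositionalEquality using (_≡_; _≢_; refl; sym; trans; cong; subst; isEquivalence)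
open import Relation.Nullary using (¬_; ¬?; Dec; yes; no; contradiction; map′)
open import Relation.Nullary.Decidable using (_×-dec_)

open import Defs

-- Fresh nodes, updated renamings and reachability.

fresh : (xs : List Node) → ∃[ m ] m ∉ xs
-- The sum bounds every entry, so its successor is none of them.
fresh xs = suc (sum xs) , λ m∈xs → 1+n≰n (∈⇒≤sum m∈xs)
  where
  ∈⇒≤sum : ∀ {x ys} → x ∈ ys → x ≤ sum ys
  ∈⇒≤sum (here refl)             = m≤m+n _ _
  ∈⇒≤sum {ys = y ∷ _} (there x∈) = m≤n⇒m≤o+n y (∈⇒≤sum x∈)

_[_↦_] : ∀ {a} {X : Set a} → (Node → X) → Node → X → Node → X
(f [ n ↦ x ]) i with i ≟ n
... | yes _ = x
... | no  _ = f i

module _ {a} {X : Set a} (f : Node → X) {n : Node} {x : X} where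

  update-same : (f [ n ↦ x ]) n ≡ x
  update-same with n ≟ n
  ... | yes _   = refl
  ... | no  n≢n = contradiction refl n≢n

  update-other : ∀ {i} → i ≢ n → (f [ n ↦ x ]) i ≡ f i
  update-other {i} i≢n with i ≟ n
  ... | yes i≡n = contradiction i≡n i≢n
  ... | no  _   = refl

edge⇒≼* : ∀ {G n p m} → (n ≼[ p ] m) ∈ G → G ⊢ n ≼*[ p ] m
edge⇒≼* e∈G with ∈-∃++ e∈G
... | _ , _ , refl = rel-ax

flip : ∀ {G n m} p → G ⊢ n ≼*[ p ] m → G ⊢ m ≼*[ opposite p ] n
flip {G} {n} {m} p r = rel-flip (subst (G ⊢ n ≼*[_] m) (sym (opposite-involutive p)) r)

∈-involutive : ∀ {Γ A n} p → (p ▸ A at n) ∈ Γ → (opposite (opposite p) ▸ A at n) ∈ Γ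
∈-involutive {Γ} {A} {n} p = subst (λ q → (q ▸ A at n) ∈ Γ) (sym (opposite-involutive p))

-- Edges may go to paths, even trivial ones, so a renaming can collapse a fresh node onto any node
-- already reachable.
Maps : (Node → Node) → Graph → Graph → Set
Maps f G G' = ∀ {n p m} → (n ≼[ p ] m) ∈ G → G' ⊢ f n ≼*[ p ] f m

≼*-map : ∀ {f G G' n p m} → Maps f G G' → G ⊢ n ≼*[ p ] m → G' ⊢ f n ≼*[ p ] f m
≼*-map h (rel-ax {G}) = h (∈-++⁺ʳ G (here refl))
≼*-map h rel-refl         = rel-refl
≼*-map h (rel-trans r r') = rel-trans (≼*-map h r) (≼*-map h r')
≼*-map h (rel-flip r)     = rel-flip (≼*-map h r)

⊆⇒Maps : ∀ {G G'} → G ⊆ G' → Maps id G G'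
⊆⇒Maps G⊆G' e∈G = edge⇒≼* (G⊆G' e∈G)

≼*-mono : ∀ {G G' n p m} → G ⊆ G' → G ⊢ n ≼*[ p ] m → G' ⊢ n ≼*[ p ] m
≼*-mono = ≼*-map ∘ ⊆⇒Maps

-- One-sided refutations and their structural properties.

-- A one-sided (tableau) form of DIL: a goal p A@n is the hypothesis p̄ A@n, and
-- the axiom cuts amount to keeping every principal formula.  The eigenvariable
-- condition is cofinite, so that no rule has to be renamed under weakening.
data Refutes (G : Graph) (Γ : Context) : Set where

  close : ∀ {p A n m} →
    (p ▸ A at n) ∈ Γ → (opposite p ▸ A at m) ∈ Γ → G ⊢ n ≼*[ p ] m →
    Refutes G Γ

  close-unit : ∀ {p n} →
    (opposite p ▸ ⟨ p ⟩ at n) ∈ Γ →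
    Refutes G Γ

  both : ∀ {p A B n} →
    (p ▸ A ∧[ p ] B at n) ∈ Γ →
    Refutes G ((p ▸ A at n) ∷ (p ▸ B at n) ∷ Γ) →
    Refutes G Γ

  branch : ∀ {p A B n} →
    (opposite p ▸ A ∧[ p ] B at n) ∈ Γ →
    Refutes G ((opposite p ▸ A at n) ∷ Γ) →
    Refutes G ((opposite p ▸ B at n) ∷ Γ) →
    Refutes G Γ

  visit : ∀ {p A B n m} →
    (p ▸ A ⇒[ p ] B at n) ∈ Γ → G ⊢ n ≼*[ p ] m →
    Refutes G ((opposite p ▸ A at m) ∷ Γ) →
    Refutes G ((p ▸ B at m) ∷ Γ) →
    Refutes G Γ

  create : ∀ {p A B n} →
    (opposite p ▸ A ⇒[ p ] B at n) ∈ Γ → (L : List Node) →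
    (∀ m → m ∉ L →
      Refutes ((n ≼[ p ] m) ∷ G) ((p ▸ A at m) ∷ (opposite p ▸ B at m) ∷ Γ)) →
    Refutes G Γ

-- Γ already contains what the invertible single-premise rule would add for p A@n.
Expanded : Graph → Context → Sign → Formula → Node → Set
Expanded G Γ p (atom a)     n = ⊥
Expanded G Γ p ⟨ q ⟩        n = p ≡ q
Expanded G Γ p (A ∧[ q ] B) n =
  p ≡ q × (p ▸ A at n) ∈ Γ × (p ▸ B at n) ∈ Γ
Expanded G Γ p (A ⇒[ q ] B) n =
  p ≡ opposite q ×
  ∃[ m ] (G ⊢ n ≼*[ q ] m × (q ▸ A at m) ∈ Γ × (p ▸ B at m) ∈ Γ)

-- Persistence: the truth of `p ▸ A` passes along `≼*[ p ]`, so a copy at a `p`-predecessor does the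
-- work of one at `n`.
Kept : Graph → Context → Sign → Formula → Node → Set
Kept G Γ p A n = ∃[ k ] (G ⊢ k ≼*[ p ] n × (p ▸ A at k) ∈ Γ)

Covered : Graph → Context → Sign → Formula → Node → Set
Covered G Γ p A n = Kept G Γ p A n ⊎ Expanded G Γ p A n

present : ∀ {G Γ p A n} → (p ▸ A at n) ∈ Γ → Covered G Γ p A n
present s∈ = inj₁ (_ , rel-refl , s∈)

covered-mono : ∀ {G G' Γ Γ'} → G ⊆ G' → Γ ⊆ Γ' →
  ∀ {p} A {n} → Covered G Γ p A n → Covered G' Γ' p A n
covered-mono g c _ (inj₁ (k , r , s∈)) = inj₁ (k , ≼*-mono g r , c s∈)
covered-mono g c (atom _) (inj₂ ())
covered-mono g c ⟨ _ ⟩ (inj₂ e) = inj₂ e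
covered-mono g c (_ ∧[ _ ] _) (inj₂ (e , a , b)) = inj₂ (e , c a , c b)
covered-mono g c (_ ⇒[ _ ] _) (inj₂ (e , m , r , a , b)) =
  inj₂ (e , m , ≼*-mono g r , c a , c b)

-- A kept opposite closes along the composed path. An expanded one supplies the hypotheses that
-- close both branches of the rule for `p ▸ A`; for an implication, its witness is the node to
-- visit.
refute-kept : ∀ {G Γ n m} p A → Kept G Γ p A n → Covered G Γ (opposite p) A m →
  G ⊢ n ≼*[ p ] m → Refutes G Γ
refute-kept p A (k , kn , s∈) (inj₁ (k' , k'm , s'∈)) nm =
  close s∈ s'∈ (rel-trans kn (rel-trans nm (rel-flip k'm)))
refute-kept {G} {Γ} p ⟨ q ⟩ (k , kn , s∈) (inj₂ e) nm =
  close-unit {p = q} (subst (λ r → (r ▸ ⟨ q ⟩ at k) ∈ Γ)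
    (trans (sym (opposite-involutive p)) (cong opposite e)) s∈)
refute-kept {G} {Γ} p (A ∧[ q ] B) (k , kn , s∈) (inj₂ (refl , a , b)) nm =
  branch (∈-involutive p s∈)
    (close (there a) (here refl) (flip p (rel-trans kn nm)))
    (close (there b) (here refl) (flip p (rel-trans kn nm)))
refute-kept + (A ⇒[ + ] B) (k , kn , s∈) (inj₂ (refl , m' , r , a , b)) nm =
  visit s∈ (rel-trans kn (rel-trans nm r))
    (close (there a) (here refl) rel-refl)
    (close (here refl) (there b) rel-refl)
refute-kept - (A ⇒[ - ] B) (k , kn , s∈) (inj₂ (refl , m' , r , a , b)) nm =
  visit s∈ (rel-trans kn (rel-trans nm r))
    (close (there a) (here refl) rel-refl)
    (close (here refl) (there b) rel-refl)

not-both-expanded : ∀ {G Γ n m} p A →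
  Expanded G Γ p A n → ¬ Expanded G Γ (opposite p) A m
not-both-expanded p ⟨ _ ⟩ refl e = s≢opposite[s] p (sym e)
not-both-expanded p (_ ∧[ _ ] _) (refl , _) (e , _) = s≢opposite[s] p (sym e)
not-both-expanded + (_ ⇒[ - ] _) _ (() , _)
not-both-expanded - (_ ⇒[ + ] _) _ (() , _)

refute-covered : ∀ {G Γ n m} p A → Covered G Γ p A n → Covered G Γ (opposite p) A m →
  G ⊢ n ≼*[ p ] m → Refutes G Γ
refute-covered p A (inj₁ k) c nm = refute-kept p A k c nm
refute-covered {G} {Γ} {n} p A (inj₂ e) (inj₁ k) nm =
  refute-kept (opposite p) A k
    (subst (λ q → Covered G Γ q A n) (sym (opposite-involutive p)) (inj₂ e)) (flip p nm)
refute-covered p A (inj₂ e) (inj₂ e') nm = ⊥-elim (not-both-expanded p A e e')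

Covers : (Node → Node) → Context → Graph → Context → Set
Covers f Γ G' Γ' = ∀ {p A n} → (p ▸ A at n) ∈ Γ → Covered G' Γ' p A (f n)

covers-∷ : ∀ {f Γ G' Γ' p A n} → Covered G' Γ' p A (f n) → Covers f Γ G' Γ' →
  Covers f ((p ▸ A at n) ∷ Γ) G' Γ'
covers-∷ c h (here refl) = c
covers-∷ c h (there s∈)  = h s∈

covers-mono : ∀ {f Γ G G' Γ' Γ''} → G ⊆ G' → Γ' ⊆ Γ'' → Covers f Γ G Γ' → Covers f Γ G' Γ''
covers-mono g c h s∈ = covered-mono g c _ (h s∈)

edge-nodes : ∀ {G n p m} → (n ≼[ p ] m) ∈ G → n ∈ nodesᴳ G × m ∈ nodesᴳ G
edge-nodes (here refl) = here refl , there (here refl)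
edge-nodes (there e∈)  = let (a , b) = edge-nodes e∈ in there (there a) , there (there b)

module _ {f : Node → Node} {m m' : Node} where

  private f' = f [ m ↦ m' ]

  update-Maps : ∀ {G G'} → m ∉ nodesᴳ G → Maps f G G' → Maps f' G G'
  update-Maps {G} {G'} m∉ h {n} {p} {k} e∈G =
    subst (λ x → G' ⊢ x ≼*[ p ] f' k) (sym (unchanged (proj₁ (edge-nodes e∈G))))
      (subst (λ x → G' ⊢ f n ≼*[ p ] x) (sym (unchanged (proj₂ (edge-nodes e∈G)))) (h e∈G))
    where
    unchanged : ∀ {i} → i ∈ nodesᴳ G → f' i ≡ f i
    unchanged i∈ = update-other f (λ { refl → m∉ i∈ })

  update-Covers : ∀ {Γ G' Γ'} → m ∉ nodesᶜ Γ → Covers f Γ G' Γ' → Covers f' Γ G' Γ'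
  update-Covers {Γ} {G'} {Γ'} m∉ h {p} {A} s∈ =
    subst (Covered G' Γ' p A)
      (sym (update-other f (λ { refl → m∉ (∈-map⁺ SignedFormula.node s∈) }))) (h s∈)

-- Weakening, contraction, renaming, monotonicity along ≼* and inversion of the
-- single-premise rules, all at once.
transfer : ∀ {G Γ G' Γ'} f → Refutes G Γ → Maps f G G' → Covers f Γ G' Γ' → Refutes G' Γ'
transfer f (close {p} {A} s∈ s'∈ r) g c = refute-covered p A (c s∈) (c s'∈) (≼*-map g r)
transfer f (close-unit {p} s∈) g c with c s∈
... | inj₁ (_ , _ , s'∈) = close-unit s'∈
... | inj₂ e             = ⊥-elim (s≢opposite[s] p (sym e))
transfer f (both s∈ d) g c with c s∈
... | inj₁ (k , r , s'∈) =
      both s'∈ (transfer f d g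
        (covers-∷ (inj₁ (k , r , here refl))
        (covers-∷ (inj₁ (k , r , there (here refl)))
        (covers-mono id (there ∘ there) c))))
... | inj₂ (_ , a , b)   = transfer f d g (covers-∷ (present a) (covers-∷ (present b) c))
transfer f (branch {p} s∈ d d') g c with c s∈
... | inj₁ (k , r , s'∈) =
      branch s'∈
        (transfer f d g (covers-∷ (inj₁ (k , r , here refl)) (covers-mono id there c)))
        (transfer f d' g (covers-∷ (inj₁ (k , r , here refl)) (covers-mono id there c)))
... | inj₂ (e , _)       = ⊥-elim (s≢opposite[s] p (sym e))
transfer f (visit {p} s∈ nm d d') g c with c s∈
... | inj₁ (k , r , s'∈) =
      visit s'∈ (rel-trans r (≼*-map g nm))
        (transfer f d g (covers-∷ (present (here refl)) (covers-mono id there c)))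
        (transfer f d' g (covers-∷ (present (here refl)) (covers-mono id there c)))
... | inj₂ (e , _)       = ⊥-elim (s≢opposite[s] p e)
transfer {G} {Γ} {G'} {Γ'} f (create {p} {A} {B} {n} s∈ L d) g c = at-image (c s∈)
  where
  m  = proj₁ (fresh (L ++ nodesᴳ G ++ nodesᶜ Γ))
  m∉ = proj₂ (fresh (L ++ nodesᴳ G ++ nodesᶜ Γ))

  -- The premise is taken at a node `m` fresh for the source, so redirecting `f` at `m` disturbs no
  -- other image. The target `m'` may be an old node that already satisfies what the premise adds.
  into : ∀ {G'' Γ''} m' → Maps f G G'' → Covers f Γ G'' Γ'' → G'' ⊢ f n ≼*[ p ] m' →
    (p ▸ A at m') ∈ Γ'' → (opposite p ▸ B at m') ∈ Γ'' → Refutes G'' Γ''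
  into {G''} {Γ''} m' g c r a b =
    transfer f' (d m (m∉ ∘ ∈-++⁺ˡ))
      (λ { (here refl) → subst (λ x → G'' ⊢ x ≼*[ p ] f' m) (sym f'n≡fn)
                           (subst (λ x → G'' ⊢ f n ≼*[ p ] x) (sym f'm≡m') r)
         ; (there e∈)  → update-Maps (m∉ ∘ ∈-++⁺ʳ L ∘ ∈-++⁺ˡ) g e∈ })
      (covers-∷ (subst (Covered G'' Γ'' p A) (sym f'm≡m') (present a))
      (covers-∷ (subst (Covered G'' Γ'' (opposite p) B) (sym f'm≡m') (present b))
      (update-Covers m∉Γ c)))
    where
    f' = f [ m ↦ m' ]
    m∉Γ : m ∉ nodesᶜ Γ
    m∉Γ = m∉ ∘ ∈-++⁺ʳ L ∘ ∈-++⁺ʳ (nodesᴳ G)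
    f'm≡m' : f' m ≡ m'
    f'm≡m' = update-same f {m}
    f'n≡fn : f' n ≡ f n
    f'n≡fn = update-other f λ n≡m →
      m∉Γ (subst (_∈ nodesᶜ Γ) n≡m (∈-map⁺ SignedFormula.node s∈))

  at-image : Covered G' Γ' (opposite p) (A ⇒[ p ] B) (f n) → Refutes G' Γ'
  -- Freshness matters only on the source side: every `m'` is a legitimate image of `m`, hence the
  -- empty exclusion list.
  at-image (inj₁ (k , r , s'∈)) = create s'∈ [] λ m' _ →
    into m' (≼*-mono there ∘ g) (covers-mono there (there ∘ there) c)
      (rel-trans (≼*-mono there (rel-flip r)) (edge⇒≼* (here refl)))
      (here refl) (there (here refl))
  at-image (inj₂ (_ , m' , r , a , b)) = into m' g c r a b

weaken : ∀ {G Γ G' Γ'} → G ⊆ G' → Γ ⊆ Γ' → Refutes G Γ → Refutes G' Γ'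
weaken g c d = transfer id d (⊆⇒Maps g) (present ∘ c)

-- Used in cut elimination both to contract a hypothesis against a persistent copy and to invert it
-- into its components.
replace : ∀ {G Γ p A n} → Covered G Γ p A n → Refutes G ((p ▸ A at n) ∷ Γ) → Refutes G Γ
replace c d = transfer id d (⊆⇒Maps id) (covers-∷ c present)

-- Translation of refutations into DIL.

use-hyp : ∀ {G Γ p q A B n m} → (q ▸ B at m) ∈ Γ ∷ʳ (opposite p ▸ A at n) →
  G ⨾ Γ ∷ʳ (opposite p ▸ A at n) ⊢ opposite q ▸ B at m → G ⨾ Γ ⊢ p ▸ A at n
-- The two axiom cuts differ in whether the hypothesis has the sign of the goal or its opposite, so
-- the signs select the rule.
use-hyp {p = +} {+} = axCut
use-hyp {p = +} { - } = axCutBar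
use-hyp {p = - } {+} = axCutBar
use-hyp {p = - } { - } = axCut

use-opposite-hyp : ∀ {G Γ p q A B n m} →
  (opposite q ▸ B at m) ∈ Γ ∷ʳ (opposite p ▸ A at n) →
  G ⨾ Γ ∷ʳ (opposite p ▸ A at n) ⊢ q ▸ B at m → G ⨾ Γ ⊢ p ▸ A at n
use-opposite-hyp {q = +} = use-hyp
use-opposite-hyp {q = - } = use-hyp

ax∈ : ∀ {G Γ p A n m} → (p ▸ A at n) ∈ Γ → G ⊢ n ≼*[ p ] m → G ⨾ Γ ⊢ p ▸ A at m
ax∈ s∈ r with ∈-∃++ s∈
... | _ , _ , refl = ax r

-- DIL puts `opposite` on the connective, `Refutes` on the sign; the two agree once the sign is a
-- constructor.
∧-opposite₁ : ∀ {G Γ A B n} p → G ⨾ Γ ⊢ opposite p ▸ A at n →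
  G ⨾ Γ ⊢ opposite p ▸ A ∧[ p ] B at n
∧-opposite₁ + = andBar₁
∧-opposite₁ - = andBar₁

∧-opposite₂ : ∀ {G Γ A B n} p → G ⨾ Γ ⊢ opposite p ▸ B at n →
  G ⨾ Γ ⊢ opposite p ▸ A ∧[ p ] B at n
∧-opposite₂ + = andBar₂
∧-opposite₂ - = andBar₂

⇒-opposite : ∀ {G Γ A B n m} p → G ⊢ n ≼*[ p ] m → G ⨾ Γ ⊢ p ▸ A at m →
  G ⨾ Γ ⊢ opposite p ▸ B at m → G ⨾ Γ ⊢ opposite p ▸ A ⇒[ p ] B at n
⇒-opposite + = impBar
⇒-opposite - = impBar

∈-∷ʳ : ∀ {Γ : Context} {s} → s ∈ Γ ∷ʳ s
∈-∷ʳ {Γ} = ∈-++⁺ʳ Γ (here refl)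

∈-∷ʳ-involutive : ∀ {Γ A n} p → (p ▸ A at n) ∈ Γ ∷ʳ (opposite (opposite p) ▸ A at n)
∈-∷ʳ-involutive {Γ} {A} {n} p = subst (λ q → (p ▸ A at n) ∈ Γ ∷ʳ (q ▸ A at n))
  (sym (opposite-involutive p)) ∈-∷ʳ

-- An axiom cut stores the negated goal and makes the opposite of any hypothesis the new goal, so
-- each tableau rule becomes a DIL rule on its principal formula. The inclusions absorb the order:
-- DIL appends where `Refutes` prepends.
refutes⇒⊢ : ∀ {G G' Γ Γ' p A n} → Refutes G Γ → G ⊆ G' → Γ ⊆ Γ' ∷ʳ (opposite p ▸ A at n) →
  G' ⨾ Γ' ⊢ p ▸ A at n
refutes⇒⊢ (close {q} s∈ s'∈ r) g c =
  use-opposite-hyp {q = q} (c s'∈) (ax∈ (c s∈) (≼*-mono g r))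
refutes⇒⊢ (close-unit {q} s∈) g c = use-opposite-hyp {q = q} (c s∈) unit
refutes⇒⊢ {Γ' = Γ'} (both {q} s∈ d) g c =
  -- `andBar₁` and `andBar₂` each keep one conjunct, so the principal formula is cut in twice; the
  -- second cut stores the first conjunct.
  use-hyp (c s∈) (∧-opposite₁ q
    (use-hyp (∈-++⁺ˡ (c s∈)) (∧-opposite₂ q
      (refutes⇒⊢ d g (∈-∷⁺ʳ (∈-++⁺ˡ (∈-∷ʳ-involutive {Γ' ∷ʳ _} q))
        (∈-∷⁺ʳ (∈-∷ʳ-involutive q) (∈-++⁺ˡ ∘ ∈-++⁺ˡ ∘ c)))))))
refutes⇒⊢ (branch {q} s∈ d d') g c =
  use-opposite-hyp {q = q} (c s∈)
    (and (refutes⇒⊢ d g (∈-∷⁺ʳ ∈-∷ʳ (∈-++⁺ˡ ∘ c)))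
         (refutes⇒⊢ d' g (∈-∷⁺ʳ ∈-∷ʳ (∈-++⁺ˡ ∘ c))))
refutes⇒⊢ (visit {q} s∈ r d d') g c =
  use-hyp (c s∈) (⇒-opposite q (≼*-mono g r)
    (refutes⇒⊢ d g (∈-∷⁺ʳ ∈-∷ʳ (∈-++⁺ˡ ∘ c)))
    (refutes⇒⊢ d' g (∈-∷⁺ʳ (∈-∷ʳ-involutive q) (∈-++⁺ˡ ∘ c))))
refutes⇒⊢ {G' = G'} {Γ' = Γ'} {p} {A} {n} (create {q} s∈ L d) g c =
  use-opposite-hyp {q = q} (c s∈)
    (imp (m∉ ∘ ∈-++⁺ʳ L ∘ ∈-++⁺ˡ) (m∉ ∘ ∈-++⁺ʳ L ∘ ∈-++⁺ʳ (nodesᴳ G'))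
      (refutes⇒⊢ (d m (m∉ ∘ ∈-++⁺ˡ))
        (∈-∷⁺ʳ (∈-++⁺ʳ G' (here refl)) (∈-++⁺ˡ ∘ g))
        (∈-∷⁺ʳ (∈-++⁺ˡ (∈-∷ʳ {Γ' ∷ʳ _})) (∈-∷⁺ʳ ∈-∷ʳ (∈-++⁺ˡ ∘ ∈-++⁺ˡ ∘ c)))))
  where
  -- Besides `L`, the node of the stored goal must be avoided: it belongs to the context by the time
  -- `imp` applies.
  used = L ++ nodesᴳ G' ++ nodesᶜ (Γ' ∷ʳ (opposite p ▸ A at n))
  m  = proj₁ (fresh used)
  m∉ = proj₂ (fresh used)

-- Admissibility of cut.

Cut : Formula → Set
Cut A = ∀ {G Γ n} p → Refutes G ((p ▸ A at n) ∷ Γ) → Refutes G ((opposite p ▸ A at n) ∷ Γ) →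
  Refutes G Γ

-- The induction hypothesis, passed as an argument so that the outer recursion runs on the cut
-- formula and the inner one on a refutation.
CutParts : Formula → Set
CutParts (atom _)     = ⊤
CutParts ⟨ _ ⟩        = ⊤
CutParts (A ∧[ _ ] B) = Cut A × Cut B
CutParts (A ⇒[ _ ] B) = Cut A × Cut B

-- The side of a cut on which the induction runs: the opposite sign of such a
-- formula is decomposed by an invertible rule.
Synchronous : Sign → Formula → Set
Synchronous p (atom _)     = ⊤
Synchronous p ⟨ q ⟩        = p ≡ opposite q
Synchronous p (_ ∧[ q ] _) = p ≡ opposite q
Synchronous p (_ ⇒[ q ] _) = p ≡ q

exchange : ∀ {s t : SignedFormula} {Γ Δ} → Γ ⊆ s ∷ Δ → t ∷ Γ ⊆ s ∷ t ∷ Δ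
exchange c = ∈-∷⁺ʳ (there (here refl)) (λ u∈ → case c u∈ of λ where
  (here refl) → here refl
  (there u∈Δ) → there (there u∈Δ))

-- Induction on the refutation of the synchronous side, permuting the cut upwards until its formula
-- is principal. The other refutation is never analysed: `replace` inverts its cut formula, and cuts
-- on the parts remain. The inclusion of `Δ` leaves the place of the cut formula free, which keeps
-- recursive calls on subterms.
cut-synchronous : ∀ {G Γ Δ n} p A → CutParts A → Synchronous p A →
  Refutes G Δ → Δ ⊆ (p ▸ A at n) ∷ Γ → Refutes G ((opposite p ▸ A at n) ∷ Γ) → Refutes G Γ
cut-synchronous {G} {Γ} p A parts syn (close {q} s∈ s'∈ r) c e with c s∈ | c s'∈
... | there t∈   | there t'∈  = close t∈ t'∈ r
-- Closing against the cut formula means that `Γ` has a persistent copy of its opposite, which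
-- covers the cut formula of `e`.
... | here refl  | there t'∈  = replace (inj₁ (_ , flip q r , t'∈)) e
... | there t∈   | here refl  =
      replace (inj₁ (subst (λ q' → Kept G Γ q' A _) (sym (opposite-involutive q)) (_ , r , t∈))) e
... | here refl  | here same  =
      ⊥-elim (s≢opposite[s] q (sym (cong SignedFormula.sign same)))
cut-synchronous p A parts syn (close-unit {q} s∈) c e with c s∈
... | there t∈  = close-unit t∈
... | here refl = replace (inj₂ (opposite-involutive q)) e
cut-synchronous p A parts syn (both {q} s∈ d) c e with c s∈
... | there t∈  = both t∈ (cut-synchronous p A parts syn d (exchange (exchange c))
                            (weaken id (∷⁺ʳ _ (there ∘ there)) e))
-- A synchronous formula is never principal in a single-premise rule.
... | here refl = ⊥-elim (s≢opposite[s] q syn)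
cut-synchronous {G} {Γ} p A parts syn (branch {q} {A'} {B'} {n} s∈ d d') c e =
  principal (c s∈) parts e
  where
  ih  = cut-synchronous p A parts syn d (exchange c) (weaken id (∷⁺ʳ _ there) e)
  ih' = cut-synchronous p A parts syn d' (exchange c) (weaken id (∷⁺ʳ _ there) e)
  principal : (opposite q ▸ A' ∧[ q ] B' at n) ∈ (p ▸ A at _) ∷ Γ → CutParts A →
    Refutes G ((opposite p ▸ A at _) ∷ Γ) → Refutes G Γ
  principal (there t∈) _ _ = branch t∈ ih ih'
  principal (here refl) (cutA , cutB) e =
    cutB q
      (cutA q
        (replace (inj₂ (opposite-involutive q , ∈-involutive q (here refl)
                                              , ∈-involutive q (there (here refl))))
          (weaken id (∷⁺ʳ _ (there ∘ there)) e))
        (weaken id (∷⁺ʳ _ there) ih))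
      ih'
cut-synchronous {G} {Γ} p A parts syn (visit {q} {A'} {B'} {n} {m} s∈ r d d') c e =
  principal (c s∈) parts e
  where
  ih  = cut-synchronous p A parts syn d (exchange c) (weaken id (∷⁺ʳ _ there) e)
  ih' = cut-synchronous p A parts syn d' (exchange c) (weaken id (∷⁺ʳ _ there) e)
  principal : (q ▸ A' ⇒[ q ] B' at n) ∈ (p ▸ A at _) ∷ Γ → CutParts A →
    Refutes G ((opposite p ▸ A at _) ∷ Γ) → Refutes G Γ
  principal (there t∈) _ _ = visit t∈ r ih ih'
  principal (here refl) (cutA , cutB) e =
    cutB q ih'
      (cutA q
        -- The node reached by `visit` becomes the witness of the inverted implication.
        (replace (inj₂ (refl , m , r , here refl , there (here refl)))
          (weaken id (∷⁺ʳ _ (there ∘ there)) e))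
        (weaken id (∷⁺ʳ _ there) ih))
cut-synchronous p A parts syn (create {q} s∈ L d) c e with c s∈
... | there t∈  = create t∈ L λ m m∉ →
      cut-synchronous p A parts syn (d m m∉) (exchange (exchange c))
        (weaken there (∷⁺ʳ _ (there ∘ there)) e)
... | here refl = ⊥-elim (s≢opposite[s] q (sym syn))

synchronous? : ∀ p A → Synchronous p A ⊎ Synchronous (opposite p) A
synchronous? p (atom _)     = inj₁ tt
synchronous? + ⟨ + ⟩        = inj₂ refl
synchronous? + ⟨ - ⟩        = inj₁ refl
synchronous? - ⟨ + ⟩        = inj₁ refl
synchronous? - ⟨ - ⟩        = inj₂ refl
synchronous? + (_ ∧[ + ] _) = inj₂ refl
synchronous? + (_ ∧[ - ] _) = inj₁ refl
synchronous? - (_ ∧[ + ] _) = inj₁ refl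
synchronous? - (_ ∧[ - ] _) = inj₂ refl
synchronous? + (_ ⇒[ + ] _) = inj₁ refl
synchronous? + (_ ⇒[ - ] _) = inj₂ refl
synchronous? - (_ ⇒[ + ] _) = inj₂ refl
synchronous? - (_ ⇒[ - ] _) = inj₁ refl

cut-from-parts : ∀ A → CutParts A → Cut A
cut-from-parts A parts {G} {Γ} p d e with synchronous? p A
... | inj₁ syn = cut-synchronous p A parts syn d id e
... | inj₂ syn = cut-synchronous (opposite p) A parts syn e id
      (subst (λ q → Refutes G ((q ▸ A at _) ∷ Γ)) (sym (opposite-involutive p)) d)

cut : ∀ A → Cut A
cut (atom a)     = cut-from-parts (atom a) tt
cut ⟨ q ⟩        = cut-from-parts ⟨ q ⟩ tt
cut (A ∧[ q ] B) = cut-from-parts (A ∧[ q ] B) (cut A , cut B)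
cut (A ⇒[ q ] B) = cut-from-parts (A ⇒[ q ] B) (cut A , cut B)

-- Subformula closures and complete signed types.

infix 4 _≟ᶠ_

_≟ᶠ_ : DecidableEquality Formula
atom a ≟ᶠ atom b = map′ (cong atom) (λ { refl → refl }) (a ≟ b)
⟨ p ⟩ ≟ᶠ ⟨ q ⟩ = map′ (cong ⟨_⟩) (λ { refl → refl }) (p ≟ˢ q)
(A ⇒[ p ] B) ≟ᶠ (C ⇒[ q ] D) =
  map′ (λ { (refl , refl , refl) → refl }) (λ { refl → refl , refl , refl })
    (A ≟ᶠ C ×-dec p ≟ˢ q ×-dec B ≟ᶠ D)
(A ∧[ p ] B) ≟ᶠ (C ∧[ q ] D) =
  map′ (λ { (refl , refl , refl) → refl }) (λ { refl → refl , refl , refl })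
    (A ≟ᶠ C ×-dec p ≟ˢ q ×-dec B ≟ᶠ D)
atom _       ≟ᶠ ⟨ _ ⟩        = no λ ()
atom _       ≟ᶠ (_ ⇒[ _ ] _) = no λ ()
atom _       ≟ᶠ (_ ∧[ _ ] _) = no λ ()
⟨ _ ⟩        ≟ᶠ atom _       = no λ ()
⟨ _ ⟩        ≟ᶠ (_ ⇒[ _ ] _) = no λ ()
⟨ _ ⟩        ≟ᶠ (_ ∧[ _ ] _) = no λ ()
(_ ⇒[ _ ] _) ≟ᶠ atom _       = no λ ()
(_ ⇒[ _ ] _) ≟ᶠ ⟨ _ ⟩        = no λ ()
(_ ⇒[ _ ] _) ≟ᶠ (_ ∧[ _ ] _) = no λ ()
(_ ∧[ _ ] _) ≟ᶠ atom _       = no λ ()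
(_ ∧[ _ ] _) ≟ᶠ ⟨ _ ⟩        = no λ ()
(_ ∧[ _ ] _) ≟ᶠ (_ ⇒[ _ ] _) = no λ ()

Literal : Set
Literal = Sign × Formula

Type : Set
Type = List Literal

open import Data.List.Membership.DecPropositional (≡-dec _≟ˢ_ _≟ᶠ_) using (_∈?_)

PartsIn : List Formula → Formula → Set
PartsIn Φ (atom _)     = ⊤
PartsIn Φ ⟨ _ ⟩        = ⊤
PartsIn Φ (A ∧[ _ ] B) = A ∈ Φ × B ∈ Φ
PartsIn Φ (A ⇒[ _ ] B) = A ∈ Φ × B ∈ Φ

PartsIn-mono : ∀ {Φ Ψ} → Φ ⊆ Ψ → ∀ A → PartsIn Φ A → PartsIn Ψ A
PartsIn-mono c (atom _)     _       = tt
PartsIn-mono c ⟨ _ ⟩        _       = tt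
PartsIn-mono c (_ ∧[ _ ] _) (a , b) = c a , c b
PartsIn-mono c (_ ⇒[ _ ] _) (a , b) = c a , c b

SubClosed : List Formula → Set
SubClosed Φ = ∀ {A} → A ∈ Φ → PartsIn Φ A

SubClosed-∷ : ∀ {Φ A} → PartsIn Φ A → SubClosed Φ → SubClosed (A ∷ Φ)
SubClosed-∷ parts c (here refl)     = PartsIn-mono there _ parts
SubClosed-∷ parts c {B} (there B∈Φ) = PartsIn-mono there B (c B∈Φ)

SubClosed-++ : ∀ {Φ Ψ} → SubClosed Φ → SubClosed Ψ → SubClosed (Φ ++ Ψ)
SubClosed-++ {Φ} c d {A} A∈ with ∈-++⁻ Φ A∈
... | inj₁ A∈Φ = PartsIn-mono ∈-++⁺ˡ A (c A∈Φ)
... | inj₂ A∈Ψ = PartsIn-mono (∈-++⁺ʳ Φ) A (d A∈Ψ)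

subformulas : Formula → List Formula
subformulas (atom a)     = atom a ∷ []
subformulas ⟨ p ⟩        = ⟨ p ⟩ ∷ []
subformulas (A ∧[ p ] B) = (A ∧[ p ] B) ∷ subformulas A ++ subformulas B
subformulas (A ⇒[ p ] B) = (A ⇒[ p ] B) ∷ subformulas A ++ subformulas B

∈-subformulas : ∀ A → A ∈ subformulas A
∈-subformulas (atom _)     = here refl
∈-subformulas ⟨ _ ⟩        = here refl
∈-subformulas (_ ∧[ _ ] _) = here refl
∈-subformulas (_ ⇒[ _ ] _) = here refl

subformulas-closed : ∀ A → SubClosed (subformulas A)
subformulas-closed (atom _) (here refl) = tt
subformulas-closed ⟨ _ ⟩    (here refl) = tt
subformulas-closed (A ∧[ _ ] B) =
  SubClosed-∷ (∈-++⁺ˡ (∈-subformulas A) , ∈-++⁺ʳ (subformulas A) (∈-subformulas B))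
    (SubClosed-++ (subformulas-closed A) (subformulas-closed B))
subformulas-closed (A ⇒[ _ ] B) =
  SubClosed-∷ (∈-++⁺ˡ (∈-subformulas A) , ∈-++⁺ʳ (subformulas A) (∈-subformulas B))
    (SubClosed-++ (subformulas-closed A) (subformulas-closed B))

closure : Context → List Formula
closure []                 = []
closure ((_ ▸ A at _) ∷ Γ) = subformulas A ++ closure Γ

closure-closed : ∀ Γ → SubClosed (closure Γ)
closure-closed []                 ()
closure-closed ((_ ▸ A at _) ∷ Γ) = SubClosed-++ (subformulas-closed A) (closure-closed Γ)

∈-closure : ∀ {Γ p A n} → (p ▸ A at n) ∈ Γ → A ∈ closure Γ
∈-closure (here refl) = ∈-++⁺ˡ (∈-subformulas _)
∈-closure {(_ ▸ A at _) ∷ _} (there s∈) = ∈-++⁺ʳ (subformulas A) (∈-closure s∈)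

-- Entries are signed independently, so a formula listed twice may receive both signs; such types
-- clash with themselves and do not survive elimination.
types : List Formula → List Type
types []      = [] ∷ []
types (A ∷ Φ) = map ((+ , A) ∷_) (types Φ) ++ map ((- , A) ∷_) (types Φ)

types-∷⁺ : ∀ {Φ A τ} p → τ ∈ types Φ → ((p , A) ∷ τ) ∈ types (A ∷ Φ)
types-∷⁺ + τ∈ = ∈-++⁺ˡ (∈-map⁺ ((+ , _) ∷_) τ∈)
types-∷⁺ {Φ} {A} - τ∈ = ∈-++⁺ʳ (map ((+ , A) ∷_) (types Φ)) (∈-map⁺ ((- , A) ∷_) τ∈)

types-∷⁻ : ∀ {Φ A τ} → τ ∈ types (A ∷ Φ) → ∃[ p ] ∃[ σ ] (σ ∈ types Φ × τ ≡ (p , A) ∷ σ)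
types-∷⁻ {Φ} {A} τ∈ with ∈-++⁻ (map ((+ , A) ∷_) (types Φ)) τ∈
... | inj₁ τ∈+ = let (σ , σ∈ , eq) = ∈-map⁻ ((+ , A) ∷_) τ∈+ in + , σ , σ∈ , eq
... | inj₂ τ∈- = let (σ , σ∈ , eq) = ∈-map⁻ ((- , A) ∷_) τ∈- in - , σ , σ∈ , eq

same-or-opposite : ∀ p q → p ≡ q ⊎ p ≡ opposite q
same-or-opposite + + = inj₁ refl
same-or-opposite + - = inj₂ refl
same-or-opposite - + = inj₂ refl
same-or-opposite - - = inj₁ refl

decided : ∀ {Φ τ A} p → τ ∈ types Φ → A ∈ Φ → (p , A) ∈ τ ⊎ (opposite p , A) ∈ τ
decided {A' ∷ Φ} p τ∈ A∈ with types-∷⁻ {Φ} {A'} τ∈ | A∈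
... | q , σ , σ∈ , refl | there A∈Φ = Sum.map there there (decided p σ∈ A∈Φ)
... | q , σ , σ∈ , refl | here refl with same-or-opposite q p
...   | inj₁ refl = inj₁ (here refl)
...   | inj₂ refl = inj₂ (here refl)

literal-in : ∀ {Φ τ p A} → τ ∈ types Φ → (p , A) ∈ τ → A ∈ Φ
literal-in {[]} (here refl) ()
literal-in {A' ∷ Φ} τ∈ l∈ with types-∷⁻ {Φ} {A'} τ∈ | l∈
... | q , σ , σ∈ , refl | here refl  = here refl
... | q , σ , σ∈ , refl | there l∈σ  = there (literal-in σ∈ l∈σ)

-- Types asserted at nodes, and their local consistency.

AssertedAt : Type → Node → Context → Set
AssertedAt τ n Γ = ∀ {p A} → (p , A) ∈ τ → (p ▸ A at n) ∈ Γ

-- Cuts on the formulas of `Φ` in turn make the node choose a complete type. A leaf that yields an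
-- `X` ends the search; if all leaves are refuted, the cuts assemble their refutations.
split : ∀ {ℓ} {X : Set ℓ} {G} Φ n Γ →
  (∀ {τ Δ} → τ ∈ types Φ → AssertedAt τ n Δ → Γ ⊆ Δ → X ⊎ Refutes G Δ) →
  X ⊎ Refutes G Γ
split []      n Γ h = h (here refl) (λ ()) id
split {X = X} {G} (A ∷ Φ) n Γ h with side + | side -
  where
  side : ∀ p → X ⊎ Refutes G ((p ▸ A at n) ∷ Γ)
  side p = split Φ n _ λ τ∈ on c →
    h (types-∷⁺ {Φ} p τ∈) (λ { (here refl) → c (here refl) ; (there l∈) → on l∈ }) (c ∘ there)
... | inj₁ x | _      = inj₁ x
... | inj₂ _ | inj₁ x = inj₁ x
... | inj₂ d | inj₂ e = inj₂ (cut A + d e)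

-- Uniform in graph, context and node, so that a refutation found while pruning applies wherever the
-- type is asserted later.
Refutable : Type → Set
Refutable τ = ∀ {G Γ n} → AssertedAt τ n Γ → Refutes G Γ

-- A failure of persistence along `p`. Its absence for `+` is the accessibility relation of the
-- model built below.
Clash : Sign → Type → Type → Set
Clash p τ σ = Any (λ (q , A) → q ≡ p × (opposite p , A) ∈ σ) τ

clash? : ∀ p τ σ → Dec (Clash p τ σ)
clash? p τ σ = any? (λ (q , A) → (q ≟ˢ p) ×-dec ((opposite p , A) ∈? σ)) τ

clash : ∀ {p A τ σ} → (p , A) ∈ τ → (opposite p , A) ∈ σ → Clash p τ σ
clash a b = lose a (refl , b)

clash⁻ : ∀ {p τ σ} → Clash p τ σ → ∃[ A ] ((p , A) ∈ τ × (opposite p , A) ∈ σ)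
clash⁻ c with find c
... | (_ , A) , a , refl , b = A , a , b

clash-sym : ∀ {τ σ} p → Clash p τ σ → Clash (opposite p) σ τ
clash-sym {τ} p c =
  let (A , a , b) = clash⁻ c
  in clash b (subst (λ q → (q , A) ∈ τ) (sym (opposite-involutive p)) a)

clash-refutes : ∀ {G Γ p τ σ n m} → Clash p τ σ →
  AssertedAt τ n Γ → AssertedAt σ m Γ → G ⊢ n ≼*[ p ] m → Refutes G Γ
clash-refutes c τ-at σ-at r = let (_ , a , b) = clash⁻ c in close (τ-at a) (σ-at b) r

Witness : Sign → Formula → Formula → Type → Type → Set
Witness q A B τ σ = ¬ Clash q τ σ × (q , A) ∈ σ × (opposite q , B) ∈ σ

witness? : ∀ q A B τ σ → Dec (Witness q A B τ σ)
witness? q A B τ σ = ¬? (clash? q τ σ) ×-dec ((q , A) ∈? σ) ×-dec ((opposite q , B) ∈? σ)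

-- Hintikka conditions relative to the candidate worlds `S`. An implication of its own sign is
-- tested only at `τ`: persistence carries it to the other worlds it speaks of, where the same test
-- applies.
Satisfied : List Type → Type → Sign → Formula → Set
Satisfied S τ p (atom _)     = ⊤
Satisfied S τ p ⟨ q ⟩        = p ≡ q
Satisfied S τ p (A ∧[ q ] B) =
  (p ≡ q × (p , A) ∈ τ × (p , B) ∈ τ) ⊎
  (p ≡ opposite q × ((p , A) ∈ τ ⊎ (p , B) ∈ τ))
Satisfied S τ p (A ⇒[ q ] B) =
  (p ≡ q × ((opposite p , A) ∈ τ ⊎ (p , B) ∈ τ)) ⊎
  (p ≡ opposite q × Any (Witness q A B τ) S)

Saturated : List Type → Type → Set
Saturated S τ = ¬ Clash + τ τ × (∀ {p A} → (p , A) ∈ τ → Satisfied S τ p A)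

all-or : ∀ {a p x} {T : Set a} {P : T → Set p} {X : Set x} (xs : List T) →
  (∀ {t} → t ∈ xs → P t ⊎ X) → (∀ {t} → t ∈ xs → P t) ⊎ X
all-or []       h = inj₁ λ ()
all-or (t ∷ xs) h with h (here refl) | all-or xs (h ∘ there)
... | inj₂ x | _      = inj₂ x
... | inj₁ _ | inj₂ x = inj₂ x
... | inj₁ p | inj₁ f = inj₁ λ { (here refl) → p ; (there t∈) → f t∈ }

-- The invariant of the elimination: no type is dropped without a refutation.
Exhaustive : List Formula → List Type → Set
Exhaustive Φ S = ∀ {σ} → σ ∈ types Φ → σ ∈ S ⊎ Refutable σ

module _ {Φ : List Formula} (closed : SubClosed Φ) where

  -- A failed condition is itself a refutation, because a complete type contains the opposite
  -- literals that close the branches.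
  satisfied-or-refutable : ∀ {S τ p} A → Exhaustive Φ S → τ ∈ types Φ → (p , A) ∈ τ →
    Satisfied S τ p A ⊎ Refutable τ
  satisfied-or-refutable (atom _) ex τ∈ l∈ = inj₁ tt
  satisfied-or-refutable {p = p} ⟨ q ⟩ ex τ∈ l∈ with same-or-opposite p q
  ... | inj₁ p≡q  = inj₁ p≡q
  ... | inj₂ refl = inj₂ λ on → close-unit (on l∈)
  satisfied-or-refutable {p = p} (A ∧[ q ] B) ex τ∈ l∈
    with same-or-opposite p q | closed (literal-in τ∈ l∈)
  ... | inj₁ refl | A∈ , B∈ with decided q τ∈ A∈ | decided q τ∈ B∈
  ...   | inj₁ a | inj₁ b = inj₁ (inj₁ (refl , a , b))
  ...   | inj₂ a | _      = inj₂ λ on →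
          both (on l∈) (close (here refl) (there (there (on a))) rel-refl)
  ...   | inj₁ _ | inj₂ b = inj₂ λ on →
          both (on l∈) (close (there (here refl)) (there (there (on b))) rel-refl)
  satisfied-or-refutable {p = p} (A ∧[ q ] B) ex τ∈ l∈
      | inj₂ refl | A∈ , B∈ with decided q τ∈ A∈ | decided q τ∈ B∈
  ...   | inj₂ a | _      = inj₁ (inj₂ (refl , inj₁ a))
  ...   | inj₁ _ | inj₂ b = inj₁ (inj₂ (refl , inj₂ b))
  ...   | inj₁ a | inj₁ b = inj₂ λ on →
          branch (on l∈) (close (there (on a)) (here refl) rel-refl)
                         (close (there (on b)) (here refl) rel-refl)
  satisfied-or-refutable {S} {τ} {p} (A ⇒[ q ] B) ex τ∈ l∈
    with same-or-opposite p q | closed (literal-in τ∈ l∈)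
  ... | inj₁ refl | A∈ , B∈ with decided q τ∈ A∈ | decided q τ∈ B∈
  ...   | inj₂ a | _      = inj₁ (inj₁ (refl , inj₁ a))
  ...   | inj₁ _ | inj₁ b = inj₁ (inj₁ (refl , inj₂ b))
  ...   | inj₁ a | inj₂ b = inj₂ λ on →
          visit (on l∈) rel-refl (close (there (on a)) (here refl) rel-refl)
                                 (close (here refl) (there (on b)) rel-refl)
  satisfied-or-refutable {S} {τ} {p} (A ⇒[ q ] B) ex τ∈ l∈
      | inj₂ refl | A∈ , B∈ with any? (witness? q A B τ) S
  ...   | yes w = inj₁ (inj₂ (refl , w))
  -- With `X` empty, `split` can only refute: every type of the created node is excluded.
  ...   | no ¬w = inj₂ λ on → create (on l∈) [] λ m _ →
          [ ⊥-elim , id ]′ (split Φ m _ λ σ∈ σ-at c → inj₂ (no-successor on σ∈ σ-at c))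
    where
    -- A type of the new node was discarded earlier, clashes along the new edge, or disagrees with
    -- `A` or `B`; otherwise it would be a witness in `S`.
    no-successor : ∀ {G Γ Δ n m σ} → AssertedAt τ n Γ → σ ∈ types Φ → AssertedAt σ m Δ →
      ((q ▸ A at m) ∷ (opposite q ▸ B at m) ∷ Γ) ⊆ Δ → Refutes ((n ≼[ q ] m) ∷ G) Δ
    no-successor {σ = σ} on σ∈ σ-at c with ex σ∈
    ... | inj₂ refutable = refutable σ-at
    ... | inj₁ σ∈S with clash? q τ σ | decided q σ∈ A∈ | decided q σ∈ B∈
    ...   | yes cl | _      | _      =
            clash-refutes cl (c ∘ there ∘ there ∘ on) σ-at (edge⇒≼* (here refl))
    ...   | no _   | inj₂ a | _      = close (c (here refl)) (σ-at a) rel-refl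
    ...   | no _   | inj₁ _ | inj₁ b = close (σ-at b) (c (there (here refl))) rel-refl
    ...   | no ¬cl | inj₁ a | inj₂ b = contradiction (lose σ∈S (¬cl , a , b)) ¬w

  saturated-or-refutable : ∀ {S τ} → Exhaustive Φ S → τ ∈ types Φ → Saturated S τ ⊎ Refutable τ
  saturated-or-refutable {S} {τ} ex τ∈ with clash? + τ τ
  ... | yes cl = inj₂ λ on → clash-refutes cl on on rel-refl
  ... | no ¬cl with all-or τ (λ {l} → satisfied-or-refutable {S} {τ} {proj₁ l} (proj₂ l) ex τ∈)
  ...   | inj₁ sat       = inj₁ (¬cl , sat)
  ...   | inj₂ refutable = inj₂ refutable

-- Elimination of types.

record Survivors (Φ : List Formula) : Set where
  field
    survivors  : List Type
    are-types  : survivors ⊆ types Φ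
    saturated  : ∀ {τ} → τ ∈ survivors → Saturated survivors τ
    exhaustive : Exhaustive Φ survivors

-- A removal may destroy the witnesses of other types, so each round retests all candidates and `k`
-- counts those left. Earlier refutations stay valid, as `Refutable` does not mention `S`.
eliminate : ∀ {Φ} → SubClosed Φ → ∀ k S → length S ≡ k → S ⊆ types Φ → Exhaustive Φ S → Survivors Φ
eliminate closed 0 [] _ S⊆ ex =
  record { survivors = [] ; are-types = S⊆ ; saturated = λ () ; exhaustive = ex }
eliminate {Φ} closed (suc k) S len S⊆ ex
  with all-or {X = ∃[ τ ] (τ ∈ S × Refutable τ)} S
    (λ {τ} τ∈ → Sum.map₂ (λ (r : Refutable τ) → τ , τ∈ , r) (saturated-or-refutable closed ex (S⊆ τ∈)))
... | inj₁ sat = record { survivors = S ; are-types = S⊆ ; saturated = sat ; exhaustive = ex }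
... | inj₂ (τ , τ∈ , refutable) with ∈-∃++ τ∈
...   | xs , ys , refl = eliminate closed k (xs ++ ys)
        (suc-injective (trans (sym (length-++-sucʳ xs τ ys)) len)) (S⊆ ∘ reinsert) smaller
  where
  reinsert : xs ++ ys ⊆ xs ++ τ ∷ ys
  reinsert = ++⁺ʳ xs there
  smaller : Exhaustive Φ (xs ++ ys)
  smaller σ∈ with ex σ∈
  ... | inj₂ r = inj₂ r
  ... | inj₁ σ∈S with ∈-++⁻ xs σ∈S
  ...   | inj₁ σ∈xs          = inj₁ (∈-++⁺ˡ σ∈xs)
  ...   | inj₂ (here refl)   = inj₂ refutable
  ...   | inj₂ (there σ∈ys)  = inj₁ (∈-++⁺ʳ xs σ∈ys)

-- The model of surviving types.

module Canonical {Φ : List Formula} (closed : SubClosed Φ) (sv : Survivors Φ) where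

  open Survivors sv

  World : Set
  World = ∃[ τ ] τ ∈ survivors

  type-of : World → Type
  type-of = proj₁

  is-type : (w : World) → type-of w ∈ types Φ
  is-type (_ , τ∈) = are-types τ∈

  -- By completeness, a missing literal would be present with the opposite sign and clash.
  propagate : ∀ {p A} (v w : World) → ¬ Clash p (type-of v) (type-of w) →
    (p , A) ∈ type-of v → (p , A) ∈ type-of w
  propagate {p} v w ¬cl l∈ with decided p (is-type w) (literal-in {Φ} (is-type v) l∈)
  ... | inj₁ yes∈ = yes∈
  ... | inj₂ no∈  = contradiction (clash l∈ no∈) ¬cl

  model : KripkeModel
  model = record
    { W          = World
    -- Positive literals persist upwards; by completeness of types, negative ones persist downwards.
    ; R          = λ v w → ¬ Clash + (type-of v) (type-of w)
    ; V          = λ w a → (+ , atom a) ∈ type-of w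
    ; isPreorder = record
      { isEquivalence = isEquivalence
      ; reflexive     = λ { {_ , τ∈} refl → proj₁ (saturated τ∈) }
      ; trans         = λ {u} {v} {w} uv vw cl →
          let (A , a , b) = clash⁻ cl in vw (clash (propagate u v uv a) b)
      }
    ; monotone   = λ {v} {w} → propagate v w
    }

  open Semantics model

  -- Recursion on `A` for both signs at once, since implications and their duals exchange the sign
  -- of the antecedent.
  truth : ∀ p A (w : World) → (p , A) ∈ type-of w → signed p (⟦ A ⟧ w)
  truth + (atom a) w l∈ = l∈
  truth - (atom a) (_ , τ∈) l∈ = λ a∈ → proj₁ (saturated τ∈) (clash a∈ l∈)
  truth p A@(⟨ _ ⟩) (_ , τ∈) l∈ with p | proj₂ (saturated τ∈) l∈
  ... | + | refl = tt
  ... | - | refl = id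
  truth p (A ∧[ q ] B) w@(_ , τ∈) l∈ with p | q | proj₂ (saturated τ∈) l∈
  ... | + | + | inj₁ (_ , a , b)    = truth + A w a , truth + B w b
  ... | - | - | inj₁ (_ , a , b)    = [ truth - A w a , truth - B w b ]′
  ... | + | - | inj₂ (_ , inj₁ a)   = inj₁ (truth + A w a)
  ... | + | - | inj₂ (_ , inj₂ b)   = inj₂ (truth + B w b)
  ... | - | + | inj₂ (_ , inj₁ a)   = truth - A w a ∘ proj₁
  ... | - | + | inj₂ (_ , inj₂ b)   = truth - B w b ∘ proj₂
  truth + (A ⇒[ + ] B) w l∈ v@(_ , σ∈) wv a
    -- The implication persists to `v`, where its local condition decides between `A` and `B`.
    with proj₂ (saturated σ∈) (propagate w v wv l∈)
  ... | inj₁ (_ , inj₁ a∈) = ⊥-elim (truth - A v a∈ a)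
  ... | inj₁ (_ , inj₂ b∈) = truth + B v b∈
  truth - (A ⇒[ - ] B) w l∈ (v@(_ , σ∈) , vw , ¬a , b)
    -- The dual implication looks backwards, so its negative literal travels against `vw`.
    with proj₂ (saturated σ∈) (propagate w v (vw ∘ clash-sym -) l∈)
  ... | inj₁ (_ , inj₁ a∈) = ¬a (truth + A v a∈)
  ... | inj₁ (_ , inj₂ b∈) = truth - B v b∈ b
  truth - (A ⇒[ + ] B) w@(_ , τ∈) l∈ h with proj₂ (saturated τ∈) l∈
  ... | inj₂ (_ , any) = let (σ , σ∈ , wv , a , b) = find any ; v = σ , σ∈ in
        truth - B v b (h v wv (truth + A v a))
  truth + (A ⇒[ - ] B) w@(_ , τ∈) l∈ with proj₂ (saturated τ∈) l∈
  ... | inj₂ (_ , any) = let (σ , σ∈ , wv , a , b) = find any ; v = σ , σ∈ in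
        v , wv ∘ clash-sym + , truth - A v a , truth + B v b

-- Assigning surviving types to the nodes of a sequent.

Countermodel : Graph → Context → Set₁
Countermodel G Γ = Σ[ K ∈ KripkeModel ] Σ[ N ∈ NodeInterpreter K ]
  (Semantics.⟦_⟧ᴳ K N G × Semantics.⟦_⟧ᶜ K N Γ)

module _ (G : Graph) (Γ : Context) where

  private
    closed : SubClosed (closure Γ)
    closed = closure-closed Γ

    sv : Survivors (closure Γ)
    sv = eliminate closed _ (types (closure Γ)) refl id inj₁

  open Survivors sv
  open Canonical closed sv

  nodes : List Node
  nodes = nodesᴳ G ++ nodesᶜ Γ

  Assigned : (Node → World) → Node → Context → Set
  Assigned N n = AssertedAt (type-of (N n)) n

  -- Once every node has its type asserted, an edge between clashing types, or a formula absent from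
  -- the type of its node, closes `Δ`; failing both, `N` gives a countermodel by `truth`.
  realised-or-refuted : ∀ N {Δ} → Γ ⊆ Δ → (∀ {n} → n ∈ nodes → Assigned N n Δ) →
    Countermodel G Γ ⊎ Refutes G Δ
  realised-or-refuted N {Δ} Γ⊆Δ assigned with all-or G edge | all-or Γ formula
    where
    edge : ∀ {e} → e ∈ G → Semantics.⟦_⟧ᴱ model N e ⊎ Refutes G Δ
    edge {n ≼[ p ] m} e∈ with clash? p (type-of (N n)) (type-of (N m)) | edge-nodes e∈
    ... | yes cl | n∈ , m∈ =
          inj₂ (clash-refutes cl (assigned (∈-++⁺ˡ n∈)) (assigned (∈-++⁺ˡ m∈)) (edge⇒≼* e∈))
    ... | no ¬cl | _ with p
    ...   | + = inj₁ ¬cl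
    ...   | - = inj₁ (¬cl ∘ clash-sym +)
    formula : ∀ {s} → s ∈ Γ → Semantics.⟦_⟧ˢ model N s ⊎ Refutes G Δ
    formula {p ▸ A at n} s∈ with decided p (is-type (N n)) (∈-closure s∈)
    ... | inj₁ yes∈ = inj₁ (truth p A (N n) yes∈)
    ... | inj₂ no∈  = inj₂ (close (Γ⊆Δ s∈)
            (assigned (∈-++⁺ʳ (nodesᴳ G) (∈-map⁺ SignedFormula.node s∈)) no∈) rel-refl)
  ... | inj₂ d      | _           = inj₂ d
  ... | inj₁ _      | inj₂ d      = inj₂ d
  ... | inj₁ edges  | inj₁ formulas = inj₁ (model , N , tabulate edges , tabulate formulas)

  -- Invariant: a node is pending or its type is asserted, so values of `N` at pending nodes are
  -- arbitrary. A node listed twice is assigned again.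
  extend : ∀ todo N Δ → Γ ⊆ Δ → (∀ {n} → n ∈ nodes → n ∈ todo ⊎ Assigned N n Δ) →
    Countermodel G Γ ⊎ Refutes G Δ
  extend [] N Δ Γ⊆Δ inv = realised-or-refuted N Γ⊆Δ (λ n∈ → [ (λ ()) , id ]′ (inv n∈))
  extend (m ∷ todo) N Δ Γ⊆Δ inv = split (closure Γ) m Δ λ {τ} {Δ'} τ∈ on c →
    case exhaustive τ∈ of λ where
      (inj₂ refutable) → inj₂ (refutable on)
      (inj₁ τ∈S) → extend todo (N [ m ↦ τ , τ∈S ]) Δ' (c ∘ Γ⊆Δ) (still τ∈S on c)
    where
    still : ∀ {τ Δ'} (τ∈S : τ ∈ survivors) → AssertedAt τ m Δ' → Δ ⊆ Δ' →
      ∀ {n} → n ∈ nodes → n ∈ todo ⊎ Assigned (N [ m ↦ τ , τ∈S ]) n Δ'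
    still τ∈S on c {n} n∈ with n ≟ m | inv n∈
    ... | yes refl | _                 = inj₂ on
    ... | no n≢m   | inj₁ (here n≡m)   = contradiction n≡m n≢m
    ... | no _     | inj₁ (there n∈')  = inj₁ n∈'
    ... | no _     | inj₂ old          = inj₂ (c ∘ old)

  countermodel-or-refuted : Countermodel G Γ ⊎ Refutes G Γ
  -- Node `0` is arbitrary: this split provides, on each branch not refuted outright, a surviving
  -- type as default value of the interpreter.
  countermodel-or-refuted = split (closure Γ) 0 Γ λ {_} {Δ} τ∈ on c →
    case exhaustive τ∈ of λ where
      (inj₂ refutable) → inj₂ (refutable on)
      (inj₁ τ∈S)       → extend nodes (λ _ → _ , τ∈S) Δ c inj₁

¬signed-opposite : ∀ {F} p → signed p F → ¬ signed (opposite p) F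
¬signed-opposite + f ¬f = ¬f f
¬signed-opposite - ¬f f = ¬f f

theorem4p43 : (G : Graph) (Γ : Context) (p : Polarity) (A : Formula) (n : Node) →
    ((K : KripkeModel) (N : NodeInterpreter K) → Holds K N G Γ (p ▸ A at n)) →
    G ⨾ Γ ⊢ (p ▸ A at n)
-- The negated goal joins the hypotheses: refuting them derives the goal, and a model of them
-- contradicts validity.
theorem4p43 G Γ p A n valid with countermodel-or-refuted G ((opposite p ▸ A at n) ∷ Γ)
... | inj₂ d = refutes⇒⊢ d id (∈-∷⁺ʳ ∈-∷ʳ ∈-++⁺ˡ)
... | inj₁ (K , N , ⟦G⟧ , ¬⟦A⟧ ∷ ⟦Γ⟧) =
      ⊥-elim (¬signed-opposite p (valid K N ⟦G⟧ ⟦Γ⟧) ¬⟦A⟧)
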